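{- Let $M$ be a plane perfect matching on $v_1,\dots,v_{2n}$ containing edges $v_iv_l$ and $v_jv_k$, where $1\le i<j<k<l\le 2n$, $j>i+2$, $k>j+2$, $l>k+2$, and suppose that this pair of edges is flippable. Let $M'$ be the matching obtained from $M$ by replacing $v_iv_l,v_jv_k$ by $v_iv_j,v_kv_l$ and keeping all other edges. Let $D(T_M)=(a_1,\dots,a_n)$ be the outdegree sequence of the triangulation $T_M$, and let $1\le p<q\le n$ be the indices such that $a_p$ is the number of consecutive 1s in $B(M)$ starting with $b_j=b_{j+1}=1$ up to the next 0, and $a_{q+1}$ is the number of consecutive 1s in $B(M)$ starting with $b_{k+1}=1$ up to the next 0 (so that $a_q$ is the number of 1s between $b_{k-1}=0$ and $b_k=0$, i.e. $a_q=0$). Thus $$D(T_M)=(a_1,\dots,a_{p-1},a_p,a_{p+1},\dots,a_{q-1},0,a_{q+1},a_{q+2},\dots,a_n).$$ Then $D(T_{M'})=(d_1,\dots,d_n)$ is given by $$d_r=a_r\ (1\le r\le p-1),\quad d_p=0,\quad d_{p+1}=a_p-1,\quad d_{r+1}=a_r\ (p+1\le r\le q-1),\quad d_{q+1}=a_{q+1}+1,\quad d_r=a_r\ (q+2\le r\le n).$$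
   Context: Matchings: plane (non-crossing) perfect matchings on vertices $v_1,\dots,v_{2n}$ lying in this cyclic order on a circle. Each edge $v_av_b$ with $a<b$ is directed from $v_a$ to $v_b$. $B(M)=(b_1,\dots,b_{2n})$ is the sequence of outdegrees (a 0/1-sequence), and it determines $M$. The edges of $M$ partition the disk bounded by the circle into inner faces. A pair of edges $v_iv_l,v_jv_k$ ($i<j<k<l$) of $M$ is flippable if the four vertices $v_i,v_j,v_k,v_l$ are incident to a common inner face. Replacing these edges by $v_iv_j,v_kv_l$ is called a matching-flip, and the result is again a plane perfect matching. Triangulations: triangulations of a convex $(n+2)$-gon with points $p_1,\dots,p_{n+2}$ in clockwise order, with edges directed from lower to higher index. $D(T)=(d_1,\dots,d_n)$, where $d_i$ is the outdegree of $p_i$ counting all diagonals and the boundary edge $p_1p_{n+2}$, but no other boundary edge; $D(T)$ determines $T$. Bijection: $T_M$ is the triangulation for which $d_1$ is the number of 1s before the first 0 in $B(M)$ and, for $2\le i\le n$, $d_i$ is the number of 1s between the $(i-1)$-st 0 and the $i$-th 0 of $B(M)$. The map $M\mapsto T_M$ is a bijection between plane perfect matchings on $v_1,\dots,v_{2n}$ and triangulations of the convex $(n+2)$-gon. -}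

module Defs where

open import Algebra.Definitions using (Involutive)
open import Data.Fin using (Fin; toℕ; _<_; _≤_; _↑ˡ_)
open import Data.Fin.Properties using (_≟_; _<?_)
open import Data.Nat using (ℕ; zero; suc; _+_; _*_)
import Data.Nat.Properties as ℕ
open import Data.Product using (_×_; _,_; ∃-syntax)
open import Data.Sum using (_⊎_)
open import Data.Vec using (allFin; count)
open import Function using (_⇔_)
open import Level using (0ℓ)
open import Relation.Binary using (Rel; Decidable)
open import Relation.Binary.PropositionalEquality using (_≡_; _≢_)
open import Relation.Nullary using (¬_)
open import Relation.Nullary.Decidable using (_×-dec_; _⊎-dec_)

-- All indices are 0-based: v₁,…,v₂ₙ are the elements of Fin (2 * n),
-- p₁,…,pₙ₊₂ those of Fin (n + 2), and sequences of length n are functions on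
-- Fin n.

private
  variable
    m n : ℕ

-- The second index is the first one plus 1.
_⋖_ : Rel (Fin m) 0ℓ
x ⋖ y = toℕ y ≡ suc (toℕ x)

infix 4 _⋖_

-- For points in convex position, with a < b and c < d: the segments ab and cd
-- cross in their interiors.
Crosses : (a b c d : Fin m) → Set
Crosses a b c d = (a < c × c < b × b < d) ⊎ (c < a × a < d × d < b)

------------------------------------------------------------------------
-- Plane perfect matchings

-- A perfect matching is given by the fixed-point-free involution that sends
-- each vertex to the other end of its edge.  `DirectedEdge a b` says that ab is
-- an edge directed from a to b.
record PlanePerfectMatching (n : ℕ) : Set where
  field
    partner    : Fin (2 * n) → Fin (2 * n)
    involutive : Involutive _≡_ partner
    no-loops   : ∀ x → partner x ≢ x

  DirectedEdge : Rel (Fin (2 * n)) 0ℓ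
  DirectedEdge a b = a < b × partner a ≡ b

  directedEdge? : Decidable DirectedEdge
  directedEdge? a b = (a <? b) ×-dec (partner a ≟ b)

  field
    plane : ∀ a b c d → DirectedEdge a b → DirectedEdge c d → ¬ Crosses a b c d

open PlanePerfectMatching public
  using (DirectedEdge; directedEdge?)

B : PlanePerfectMatching n → Fin (2 * n) → ℕ
B {n} M x = count (directedEdge? M x) (allFin (2 * n))

-- The vertices cut the circle into arcs; arc s runs from vertex s to its
-- cyclic successor.
ArcEnd : (s x : Fin m) → Set
ArcEnd {m} s x = x ≡ s ⊎ s ⋖ x ⊎ (toℕ x ≡ 0 × suc (toℕ s) ≡ m)

-- For a < b: arc s lies on that side of the chord ab which contains the
-- vertices between a and b.
Beneath : (a b s : Fin m) → Set
Beneath a b s = a ≤ s × s < b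

-- The edges of M are chords of the disk without common points.  Hence each
-- face has at least one arc on its boundary, and two arcs bound the same face
-- exactly when no edge separates them.  Faces are therefore represented by
-- arcs, up to `SameFace`.
SameFace : PlanePerfectMatching n → Rel (Fin (2 * n)) 0ℓ
SameFace M s t = ∀ a b → DirectedEdge M a b → Beneath a b s ⇔ Beneath a b t

-- The two faces at a vertex are those bounded by the two arcs ending there.
IncidentToFace : PlanePerfectMatching n → (x f : Fin (2 * n)) → Set
IncidentToFace M x f = ∃[ s ] ArcEnd s x × SameFace M s f

FourOnCommonFace : PlanePerfectMatching n → (i j k l : Fin (2 * n)) → Set
FourOnCommonFace M i j k l = ∃[ f ]
  IncidentToFace M i f × IncidentToFace M j f ×
  IncidentToFace M k f × IncidentToFace M l f

-- For i < j < k < l.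
record FlippablePair (M : PlanePerfectMatching n) (i j k l : Fin (2 * n)) : Set where
  field
    outer      : DirectedEdge M i l
    inner      : DirectedEdge M j k
    commonFace : FourOnCommonFace M i j k l

-- E(M′) = (E(M) ∖ {il, jk}) ∪ {ij, kl}.
MatchingFlip : (M : PlanePerfectMatching n) (i j k l : Fin (2 * n)) →
               PlanePerfectMatching n → Set
MatchingFlip M i j k l M′ = ∀ a b → DirectedEdge M′ a b ⇔
  ( (a , b) ≡ (i , j)
  ⊎ (a , b) ≡ (k , l)
  ⊎ (DirectedEdge M a b × (a , b) ≢ (i , l) × (a , b) ≢ (j , k)))

------------------------------------------------------------------------
-- Triangulations of the convex (n + 2)-gon

-- Neither equal, nor consecutive, nor the first and the last point.
IsDiagonal : Rel (Fin (n + 2)) 0ℓ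
IsDiagonal {n} a b =
  a < b × ¬ (a ⋖ b) × ¬ (toℕ a ≡ 0 × toℕ b ≡ suc n)

-- A maximal set of pairwise non-crossing diagonals, each listed from its lower
-- to its higher end.
record Triangulation (n : ℕ) : Set₁ where
  field
    Diagonal    : Rel (Fin (n + 2)) 0ℓ
    diagonal?   : Decidable Diagonal
    isDiagonal  : ∀ a b → Diagonal a b → IsDiagonal {n} a b
    nonCrossing : ∀ a b c d → Diagonal a b → Diagonal c d → ¬ Crosses a b c d
    maximal     : ∀ a b → IsDiagonal {n} a b →
                  (∀ c d → Diagonal c d → ¬ Crosses a b c d) → Diagonal a b

  -- The edges that count for the outdegrees: the diagonals and p₁pₙ₊₂.
  CountedEdge : Rel (Fin (n + 2)) 0ℓ
  CountedEdge a b = Diagonal a b ⊎ (toℕ a ≡ 0 × toℕ b ≡ suc n)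

  countedEdge? : Decidable CountedEdge
  countedEdge? a b =
    diagonal? a b ⊎-dec ((toℕ a ℕ.≟ 0) ×-dec (toℕ b ℕ.≟ suc n))

open Triangulation public
  using (countedEdge?)

D : Triangulation n → Fin n → ℕ
D {n} T r = count (countedEdge? T (r ↑ˡ 2)) (allFin (n + 2))

------------------------------------------------------------------------
-- Runs of 1s in a 0/1-sequence, and the triangulation T_M

zerosBefore : (Fin m → ℕ) → Fin m → ℕ
zerosBefore {m} b x = count (λ y → (y <? x) ×-dec (b y ℕ.≟ 0)) (allFin m)

-- A 1 lies before the first 0, or between the (r-1)-st and the r-th 0, exactly
-- when r-1 zeros precede it (which is toℕ r for the 0-based r).
onesInRun : (Fin m → ℕ) → Fin n → ℕ
onesInRun {m} b r =
  count (λ x → (b x ℕ.≟ 1) ×-dec (zerosBefore b x ℕ.≟ toℕ r)) (allFin m)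

-- T is the triangulation T_M.  As D(T) determines T, there is only one such T.
_IsTriangulationOf_ : Triangulation n → PlanePerfectMatching n → Set
T IsTriangulationOf M = ∀ r → D T r ≡ onesInRun (B M) r

-- The 0 at position x is the one that ends run r.
ZeroEndsRun : (Fin m → ℕ) → Fin n → Fin m → Set
ZeroEndsRun b r x = b x ≡ 0 × zerosBefore b x ≡ toℕ r

-- Run r is nonempty and its first 1 is at position x.
RunStartsAt : (Fin m → ℕ) → Fin n → Fin m → Set
RunStartsAt b r x =
  b x ≡ 1 × zerosBefore b x ≡ toℕ r × (∀ y → y ⋖ x → b y ≡ 0)

-- p and q are the indices belonging to the positions j and k: run p starts with
-- b_j = b_{j+1} = 1, run q is enclosed by b_{k-1} = 0 and b_k = 0, and run
-- q + 1 (which exists) starts with b_{k+1} = 1.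
record RunIndices (b : Fin m → ℕ) (j k : Fin m) (p q : Fin n) : Set where
  field
    p<q       : p < q
    run-p     : RunStartsAt b p j
    b[j+1]≡1  : ∀ x → j ⋖ x → b x ≡ 1
    b[k-1]≡0  : ∀ x → x ⋖ k → b x ≡ 0
    b[k]≡0    : ZeroEndsRun b q k
    run-[q+1] : ∃[ s ] ∃[ x ] q ⋖ s × k ⋖ x × RunStartsAt b s x

module Submission where

open import Defs
import Algebra.Properties.CommutativeMonoid.Sum
open import Data.Bool using (true; false; if_then_else_)
open import Data.Empty using (⊥)
open import Data.Fin using (Fin; toℕ; _<_; _≤_; zero; suc; fromℕ<; inject₁)
open import Data.Fin.Permutation using (Permutation′; permutation)
open import Data.Fin.Properties
  using (<-cmp; _≟_; _<?_; toℕ-fromℕ<; toℕ-inject₁; toℕ-injective; toℕ<n)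
import Data.Nat as ℕ
open import Data.Nat using (ℕ; suc; _+_; _*_; _>_)
import Data.Nat.Properties as ℕ
open import Data.Product using (_×_; _,_; proj₁; proj₂; map₂; ∃-syntax)
open import Data.Product.Properties using (,-injectiveˡ)
open import Data.Sum using (inj₁; inj₂; [_,_])
open import Data.Vec using (count; tabulate; allFin)
open import Function using (_∘_; id; _⇔_; mk⇔; module Equivalence)
open import Level using (0ℓ)
open import Relation.Binary using (tri<; tri≈; tri>)
open import Relation.Binary.PropositionalEquality
  using (_≡_; _≢_; refl; sym; trans; cong; cong₂; subst; subst₂; ≢-sym; module ≡-Reasoning)
open import Relation.Nullary using (¬_; Dec; yes; no; contradiction)
open import Relation.Nullary.Decidable
  using (does; does-⇔; dec-true; dec-false; ¬?; _×-dec_)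
open import Relation.Unary using (Pred; Decidable)

open Algebra.Properties.CommutativeMonoid.Sum ℕ.+-0-commutativeMonoid
  using (sum; sum-cong-≗; ∑-distrib-+; sum-permute; sum-syntax)
open Equivalence using (to; from)

-- The flip makes one tail a head and one head a tail: i keeps outdegree 1 and l keeps 0, while j
-- drops from 1 to 0 and k rises from 0 to 1, and all other vertices keep their edges (`B-flip`). So
-- B(M′) is B(M) with the 1 at j moved to k, and the formula for D(T_M′) becomes a statement about
-- 0/1-sequences (`MoveOne`). The index of the run containing a 1 is the number of 0s before it. The
-- move raises this number by one for positions after j up to k and preserves it elsewhere
-- (`z′-left`, `z′-middle`, `z′-right`). Since j and k each follow a 0, run p of B(M) starts exactly
-- at j and run q is empty. Hence the new 0 at j leaves run p empty, the rest of the old run p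
-- becomes run p+1, the runs strictly between p and q shift by one, and the new 1 at k joins run
-- q+1.
--
-- The existence of p and q uses planarity and the common face. An edge from between i and j to
-- beyond j would separate the arcs at i from those at j (`no-separating-edge`). It follows that no
-- edge leaves the gap (i,j) or the gap (k,l); none leaves (j,k) because jk is an edge. The vertices
-- next to j and k in these gaps are therefore heads or tails as `RunIndices` demands. The run
-- indices stay below n because M has n heads (`zeros≡n`), one of which is l.

private
  variable
    m n : ℕ
    A : Set
    P Q : Pred A 0ℓ

-- Counting over finite index sets

count-cong : (P? : Decidable P) (Q? : Decidable Q) (f : Fin n → A) →
             (∀ x → P (f x) ⇔ Q (f x)) →
             count P? (tabulate f) ≡ count Q? (tabulate f)
count-cong {n = ℕ.zero} P? Q? f P⇔Q = refl
count-cong {n = suc n}  P? Q? f P⇔Q =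
  cong₂ (λ b → if b then suc else id)
    (does-⇔ (P⇔Q zero) (P? (f zero)) (Q? (f zero)))
    (count-cong P? Q? (f ∘ suc) (P⇔Q ∘ suc))

-- The source of every "plus one" below: two counts are compared through the single index at which
-- their predicates differ.
count-insert : (P? : Decidable P) (Q? : Decidable Q) (f : Fin n → A) (z : Fin n) →
               ¬ P (f z) → Q (f z) → (∀ x → x ≢ z → P (f x) ⇔ Q (f x)) →
               count Q? (tabulate f) ≡ suc (count P? (tabulate f))
count-insert P? Q? f zero ¬Pz Qz P⇔Q
  rewrite dec-false (P? (f zero)) ¬Pz | dec-true (Q? (f zero)) Qz =
  cong suc (sym (count-cong P? Q? (f ∘ suc) (λ x → P⇔Q (suc x) λ ())))
count-insert P? Q? f (suc z) ¬Pz Qz P⇔Q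
  rewrite count-insert P? Q? (f ∘ suc) z ¬Pz Qz
            (λ x x≢z → P⇔Q (suc x) λ { refl → x≢z refl })
        | does-⇔ (P⇔Q zero λ ()) (P? (f zero)) (Q? (f zero))
  with does (Q? (f zero))
... | true  = refl
... | false = refl

count-mono : (P? : Decidable P) (Q? : Decidable Q) (f : Fin n → A) →
             (∀ x → P (f x) → Q (f x)) →
             count P? (tabulate f) ℕ.≤ count Q? (tabulate f)
count-mono {n = ℕ.zero} P? Q? f P⊆Q = ℕ.z≤n
count-mono {n = suc n}  P? Q? f P⊆Q
  with count-mono P? Q? (f ∘ suc) (P⊆Q ∘ suc) | P? (f zero) | Q? (f zero)
... | le | yes _  | yes _  = ℕ.s≤s le
... | le | yes Pz | no ¬Qz = contradiction (P⊆Q zero Pz) ¬Qz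
... | le | no _   | yes _  = ℕ.m≤n⇒m≤1+n le
... | le | no _   | no _   = le

count-mono-< : {P Q : Pred (Fin n) 0ℓ} (P? : Decidable P) (Q? : Decidable Q) (z : Fin n) →
               ¬ P z → Q z → (∀ x → P x → Q x) →
               count P? (allFin n) ℕ.< count Q? (allFin n)
count-mono-< {Q = Q} P? Q? z ¬Pz Qz P⊆Q = begin-strict
  count P? (allFin _)        ≤⟨ count-mono P? Q∖z? id (λ x Px → P⊆Q x Px , λ { refl → ¬Pz Px }) ⟩
  count Q∖z? (allFin _)      <⟨ ℕ.n<1+n _ ⟩
  suc (count Q∖z? (allFin _)) ≡⟨ count-insert Q∖z? Q? id z (λ (_ , z≢z) → z≢z refl) Qz
                                  (λ x x≢z → mk⇔ proj₁ (_, x≢z)) ⟨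
  count Q? (allFin _)        ∎
  where
  open ℕ.≤-Reasoning
  Q∖z? : Decidable (λ x → Q x × x ≢ z)
  Q∖z? x = Q? x ×-dec ¬? (x ≟ z)

count-none : (P? : Decidable P) (f : Fin n → A) → (∀ x → ¬ P (f x)) →
             count P? (tabulate f) ≡ 0
count-none {n = ℕ.zero} P? f ¬P = refl
count-none {n = suc n}  P? f ¬P
  rewrite dec-false (P? (f zero)) (¬P zero) = count-none P? (f ∘ suc) (¬P ∘ suc)

indicator : {X : Set} → Dec X → ℕ
indicator d = if does d then 1 else 0

count≡sum : (P? : Decidable P) (f : Fin n → A) →
            count P? (tabulate f) ≡ ∑[ x < n ] indicator (P? (f x))
count≡sum {n = ℕ.zero} P? f = refl
count≡sum {n = suc n}  P? f with does (P? (f zero))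
... | true  = cong suc (count≡sum P? (f ∘ suc))
... | false = count≡sum P? (f ∘ suc)

sum-ones : ∀ n → ∑[ x < n ] 1 ≡ n
sum-ones ℕ.zero  = refl
sum-ones (suc n) = cong suc (sum-ones n)

neither : {X Y : Set} → ¬ X → ¬ Y → X ⇔ Y
neither ¬x ¬y = mk⇔ (λ x → contradiction x ¬x) (λ y → contradiction y ¬y)

-- Neighbouring positions, zeros before a position, and runs

predecessor : {w x : Fin m} → w < x → ∃[ y ] y ⋖ x × w ≤ y
predecessor {w = w} {suc x} (ℕ.s≤s w≤x) =
  inject₁ x , cong suc (sym (toℕ-inject₁ x)) , subst (toℕ w ℕ.≤_) (sym (toℕ-inject₁ x)) w≤x

successor : {x y : Fin m} → x < y → ∃[ z ] x ⋖ z × z ≤ y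
successor {y = y} x<y =
  fromℕ< sx<m , toℕ-fromℕ< sx<m , subst (ℕ._≤ toℕ y) (sym (toℕ-fromℕ< sx<m)) x<y
  where sx<m = ℕ.≤-<-trans x<y (toℕ<n y)

module _ (b : Fin m → ℕ) where

  ZeroBefore : Fin m → Pred (Fin m) 0ℓ
  ZeroBefore x y = y < x × b y ≡ 0

  zeroBefore? : ∀ x → Decidable (ZeroBefore x)
  zeroBefore? x y = (y <? x) ×-dec (b y ℕ.≟ 0)

  zerosBefore-mono : ∀ {x y} → x ≤ y → zerosBefore b x ℕ.≤ zerosBefore b y
  zerosBefore-mono {x} {y} x≤y =
    count-mono (zeroBefore? x) (zeroBefore? y) id
      (λ _ (z<x , bz≡0) → ℕ.<-≤-trans z<x x≤y , bz≡0)

  zerosBefore-mono-< : ∀ {x y z} → x ≤ y → y < z → b y ≡ 0 →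
                       zerosBefore b x ℕ.< zerosBefore b z
  zerosBefore-mono-< {x} {y} {z} x≤y y<z by≡0 =
    count-mono-< (zeroBefore? x) (zeroBefore? z) y
      (λ (y<x , _) → ℕ.<⇒≱ y<x x≤y) (y<z , by≡0)
      (λ _ (w<x , bw≡0) → ℕ.<-trans (ℕ.<-≤-trans w<x x≤y) y<z , bw≡0)

  -- A 0 at or after x is missed by the count at x. Together with `zeros≡n` this lets run indices be
  -- elements of `Fin n`.
  zerosBefore<zeros : ∀ {x y} → x ≤ y → b y ≡ 0 →
                      zerosBefore b x ℕ.< count (λ z → b z ℕ.≟ 0) (allFin m)
  zerosBefore<zeros {x} {y} x≤y by≡0 =
    count-mono-< (zeroBefore? x) (λ z → b z ℕ.≟ 0) y
      (λ (y<x , _) → ℕ.<⇒≱ y<x x≤y) by≡0 (λ _ → proj₂)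

  zerosBefore-suc : ∀ {x y} → x ⋖ y → b x ≡ 0 → zerosBefore b y ≡ suc (zerosBefore b x)
  zerosBefore-suc {x} {y} x⋖y bx≡0 =
    count-insert (zeroBefore? x) (zeroBefore? y) id x
      (λ (x<x , _) → ℕ.<-irrefl refl x<x) (ℕ.≤-reflexive (sym x⋖y) , bx≡0)
      λ z z≢x → mk⇔
        (λ (z<x , bz) → ℕ.<-trans z<x (ℕ.≤-reflexive (sym x⋖y)) , bz)
        (λ (z<y , bz) → ℕ.≤∧≢⇒< (ℕ.s≤s⁻¹ (subst (toℕ z ℕ.<_) x⋖y z<y)) (z≢x ∘ toℕ-injective) , bz)

  -- The 0 just before y lies at or after x, so it counts for y but not for x: no earlier position
  -- shares the run index of y.
  zerosBefore-<-run : ∀ {x y} → (∀ w → w ⋖ y → b w ≡ 0) → x < y →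
                      zerosBefore b x ℕ.< zerosBefore b y
  zerosBefore-<-run zeros x<y with predecessor x<y
  ... | w , w⋖y , x≤w = zerosBefore-mono-< x≤w (ℕ.≤-reflexive (sym w⋖y)) (zeros w w⋖y)

  InRun : ℕ → Pred (Fin m) 0ℓ
  InRun c x = b x ≡ 1 × zerosBefore b x ≡ c

  inRun? : ∀ c → Decidable (InRun c)
  inRun? c x = (b x ℕ.≟ 1) ×-dec (zerosBefore b x ℕ.≟ c)

-- The effect of moving a 1 on the run lengths

-- Moving a 1 from position j to the later position k delays every 0 in between
-- by one run, so that the runs between j and k are shifted by one index.
module MoveOne
  (b b′ : Fin m → ℕ) (j k : Fin m) (j<k : j < k)
  (bj≡1 : b j ≡ 1) (b′j≡0 : b′ j ≡ 0) (bk≡0 : b k ≡ 0) (b′k≡1 : b′ k ≡ 1)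
  (b′≡b : ∀ x → x ≢ j → x ≢ k → b′ x ≡ b x)
  (zero-before-j : ∀ y → y ⋖ j → b y ≡ 0) (zero-before-k : ∀ y → y ⋖ k → b y ≡ 0)
  where

  z z′ : Fin m → ℕ
  z  = zerosBefore b
  z′ = zerosBefore b′

  <⇒≢ : {x y : Fin m} → x < y → x ≢ y
  <⇒≢ x<y refl = ℕ.<-irrefl refl x<y

  >⇒≢ : {x y : Fin m} → y < x → x ≢ y
  >⇒≢ y<x = ≢-sym (<⇒≢ y<x)

  zero⇔ : {y : Fin m} → y ≢ j → y ≢ k → {X : Set} → (X × b y ≡ 0) ⇔ (X × b′ y ≡ 0)
  zero⇔ {y} y≢j y≢k = mk⇔ (map₂ (trans (b′≡b y y≢j y≢k))) (map₂ (trans (sym (b′≡b y y≢j y≢k))))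

  z′-left : ∀ {x} → x ≤ j → z′ x ≡ z x
  z′-left {x} x≤j = sym (count-cong (zeroBefore? b x) (zeroBefore? b′ x) id λ y → mk⇔
    (λ (y<x , by) → to (same y<x) (y<x , by)) (λ (y<x , by) → from (same y<x) (y<x , by)))
    where
    same : ∀ {y} → y < x → ZeroBefore b x y ⇔ ZeroBefore b′ x y
    same y<x = zero⇔ (<⇒≢ (ℕ.<-≤-trans y<x x≤j)) (<⇒≢ (ℕ.<-trans (ℕ.<-≤-trans y<x x≤j) j<k))

  z′-middle : ∀ {x} → j < x → x ≤ k → z′ x ≡ suc (z x)
  z′-middle {x} j<x x≤k = count-insert (zeroBefore? b x) (zeroBefore? b′ x) id j
    (λ (_ , bj≡0) → contradiction (trans (sym bj≡1) bj≡0) λ ()) (j<x , b′j≡0)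
    λ y y≢j → mk⇔
      (λ (y<x , by) → to (zero⇔ y≢j (<⇒≢ (ℕ.<-≤-trans y<x x≤k))) (y<x , by))
      (λ (y<x , by) → from (zero⇔ y≢j (<⇒≢ (ℕ.<-≤-trans y<x x≤k))) (y<x , by))

  -- Beyond k the lost 0 at k and the gained 0 at j cancel: both counts exceed by one the number of
  -- 0s of `b` before x other than k.
  z′-right : ∀ {x} → k < x → z′ x ≡ z x
  z′-right {x} k<x = trans
    (count-insert common? (zeroBefore? b′ x) id j
      (λ ((_ , bj≡0) , _) → contradiction (trans (sym bj≡1) bj≡0) λ ())
      (ℕ.<-trans j<k k<x , b′j≡0)
      λ y y≢j → mk⇔
        (λ (zy , y≢k) → to (zero⇔ y≢j y≢k) zy)
        (λ zy → let y≢k = λ { refl → contradiction (trans (sym b′k≡1) (proj₂ zy)) λ () }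
                in from (zero⇔ y≢j y≢k) zy , y≢k))
    (sym (count-insert common? (zeroBefore? b x) id k
      (λ (_ , k≢k) → k≢k refl) (k<x , bk≡0)
      λ y y≢k → mk⇔ proj₁ (_, y≢k)))
    where
    common? : Decidable (λ y → ZeroBefore b x y × y ≢ k)
    common? y = zeroBefore? b x y ×-dec ¬? (y ≟ k)

  -- Each case records how the value and the run index at x change and which run indices are
  -- possible there. The bounds in `before` and the upper bound in `between` are strict because j
  -- and k follow a 0; the bound in `after` is strict because `b` has a 0 at k. The run lemmas below
  -- are case distinctions over this type.
  data Position (x : Fin m) : Set where
    before  : b′ x ≡ b x → z′ x ≡ z x → z x ℕ.< z j → Position x
    at-j    : x ≡ j → b′ x ≡ 0 → z x ≡ z j → Position x
    between : b′ x ≡ b x → z′ x ≡ suc (z x) → z j ℕ.≤ z x → z x ℕ.< z k → x ≢ j → Position x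
    at-k    : x ≡ k → b x ≡ 0 → z′ x ≡ suc (z k) → Position x
    after   : b′ x ≡ b x → z′ x ≡ z x → z k ℕ.< z x → Position x

  position : ∀ x → Position x
  position x with <-cmp x j
  ... | tri< x<j _ _ = before
    (b′≡b x (<⇒≢ x<j) (<⇒≢ (ℕ.<-trans x<j j<k)))
    (z′-left (ℕ.<⇒≤ x<j)) (zerosBefore-<-run b zero-before-j x<j)
  ... | tri≈ _ refl _ = at-j refl b′j≡0 refl
  ... | tri> _ _ j<x with <-cmp x k
  ...   | tri< x<k _ _ = between
    (b′≡b x (>⇒≢ j<x) (<⇒≢ x<k))
    (z′-middle j<x (ℕ.<⇒≤ x<k)) (zerosBefore-mono b (ℕ.<⇒≤ j<x))
    (zerosBefore-<-run b zero-before-k x<k) (>⇒≢ j<x)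
  ...   | tri≈ _ refl _ = at-k refl bk≡0 (z′-middle j<x ℕ.≤-refl)
  ...   | tri> _ _ k<x = after
    (b′≡b x (>⇒≢ (ℕ.<-trans j<k k<x)) (>⇒≢ k<x))
    (z′-right k<x) (zerosBefore-mono-< b ℕ.≤-refl k<x bk≡0)

  zj<zk : z j ℕ.< z k
  zj<zk = zerosBefore-<-run b zero-before-k j<k

  module _ {x : Fin m} {c : ℕ} where

    one≢zero : {b : Fin m → ℕ} → b x ≡ 0 → ¬ InRun b c x
    one≢zero bx≡0 (bx≡1 , _) = contradiction (trans (sym bx≡1) bx≡0) λ ()

    earlier : {b : Fin m → ℕ} → zerosBefore b x ℕ.< c → ¬ InRun b c x
    earlier zx<c (_ , zx≡c) = ℕ.<⇒≢ zx<c zx≡c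

    later : {b : Fin m → ℕ} → c ℕ.< zerosBefore b x → ¬ InRun b c x
    later c<zx (_ , zx≡c) = ℕ.>⇒≢ c<zx zx≡c

    same-run : b′ x ≡ b x → z′ x ≡ z x → InRun b c x ⇔ InRun b′ c x
    same-run b≡ z≡ = mk⇔ (λ (o , e) → trans b≡ o , trans z≡ e)
                         (λ (o , e) → trans (sym b≡) o , trans (sym z≡) e)

    next-run : b′ x ≡ b x → z′ x ≡ suc (z x) → InRun b c x ⇔ InRun b′ (suc c) x
    next-run b≡ z≡ = mk⇔ (λ (o , e) → trans b≡ o , trans z≡ (cong suc e))
                         (λ (o , e) → trans (sym b≡) o , ℕ.suc-injective (trans (sym z≡) e))

  module _ {n : ℕ} where

    run-before : (r : Fin n) → toℕ r ℕ.< z j → onesInRun b′ r ≡ onesInRun b r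
    run-before r r<zj = sym (count-cong (inRun? b c) (inRun? b′ c) id go)
      where
      c = toℕ r
      go : ∀ x → InRun b c x ⇔ InRun b′ c x
      go x with position x
      ... | before b≡ z≡ _ = same-run b≡ z≡
      ... | at-j _ b′≡0 z≡ = neither (later (subst (c ℕ.<_) (sym z≡) r<zj)) (one≢zero b′≡0)
      ... | between _ z≡ zj≤ _ _ =
        neither (later (ℕ.<-≤-trans r<zj zj≤))
                (later (subst (c ℕ.<_) (sym z≡) (ℕ.m≤n⇒m≤1+n (ℕ.<-≤-trans r<zj zj≤))))
      ... | at-k _ b≡0 z≡ = neither (one≢zero b≡0)
        (later (subst (c ℕ.<_) (sym z≡) (ℕ.m≤n⇒m≤1+n (ℕ.<-trans r<zj zj<zk))))
      ... | after b≡ z≡ _ = same-run b≡ z≡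

    -- The new 0 at j closes run p at once: positions before j lie in earlier runs, and those after
    -- j have been pushed to later ones.
    run-j : (p : Fin n) → z j ≡ toℕ p → onesInRun b′ p ≡ 0
    run-j p zj≡p = count-none (inRun? b′ c) id go
      where
      c = toℕ p
      go : ∀ x → ¬ InRun b′ c x
      go x with position x
      ... | before _ z≡ z< = earlier (subst (ℕ._< c) (sym z≡) (subst (z x ℕ.<_) zj≡p z<))
      ... | at-j _ b′≡0 _ = one≢zero b′≡0
      ... | between _ z≡ zj≤ _ _ =
        later (subst (c ℕ.<_) (sym z≡) (ℕ.s≤s (subst (ℕ._≤ z x) zj≡p zj≤)))
      ... | at-k _ _ z≡ =
        later (subst (c ℕ.<_) (sym z≡) (ℕ.m≤n⇒m≤1+n (subst (ℕ._< z k) zj≡p zj<zk)))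
      ... | after _ z≡ zk< =
        later (subst (c ℕ.<_) (sym z≡) (ℕ.<-trans (subst (ℕ._< z k) zj≡p zj<zk) zk<))

    -- Run p of `b` consists of the 1 at j and of 1s between j and k; the latter are delayed by one
    -- run and make up run p+1 of `b′`.
    run-after-j : (p s : Fin n) → z j ≡ toℕ p → p ⋖ s → onesInRun b p ≡ suc (onesInRun b′ s)
    run-after-j p s zj≡p s≡ rewrite s≡ | sym zj≡p =
      count-insert (inRun? b′ (suc (z j))) (inRun? b (z j)) id j
        (one≢zero b′j≡0) (bj≡1 , refl) go
      where
      go : ∀ x → x ≢ j → InRun b′ (suc (z j)) x ⇔ InRun b (z j) x
      go x x≢j with position x
      ... | before _ z≡ z< =
        neither (earlier (subst (ℕ._< _) (sym z≡) (ℕ.m≤n⇒m≤1+n z<))) (earlier z<)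
      ... | at-j x≡j _ _ = contradiction x≡j x≢j
      ... | between b≡ z≡ _ _ _ = mk⇔ (from (next-run b≡ z≡)) (to (next-run b≡ z≡))
      ... | at-k _ b≡0 z≡ =
        neither (later (subst (_ ℕ.<_) (sym z≡) (ℕ.s≤s zj<zk))) (one≢zero b≡0)
      ... | after _ z≡ zk< =
        neither (later (subst (_ ℕ.<_) (sym z≡) (ℕ.≤-<-trans zj<zk zk<)))
                (later (ℕ.<-trans zj<zk zk<))

    run-between : (r s : Fin n) → z j ℕ.< toℕ r → toℕ r ℕ.< z k → r ⋖ s →
                  onesInRun b′ s ≡ onesInRun b r
    run-between r s zj<r r<zk s≡ rewrite s≡ =
      sym (count-cong (inRun? b c) (inRun? b′ (suc c)) id go)
      where
      c = toℕ r
      go : ∀ x → InRun b c x ⇔ InRun b′ (suc c) x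
      go x with position x
      ... | before _ z≡ z< =
        neither (earlier (ℕ.<-trans z< zj<r))
                (earlier (subst (ℕ._< _) (sym z≡) (ℕ.m≤n⇒m≤1+n (ℕ.<-trans z< zj<r))))
      ... | at-j _ b′≡0 z≡ = neither (earlier (subst (ℕ._< c) (sym z≡) zj<r)) (one≢zero b′≡0)
      ... | between b≡ z≡ _ _ _ = next-run b≡ z≡
      ... | at-k _ b≡0 z≡ =
        neither (one≢zero b≡0) (later (subst (_ ℕ.<_) (sym z≡) (ℕ.s≤s r<zk)))
      ... | after _ z≡ zk< =
        neither (later (ℕ.<-trans r<zk zk<))
                (later (subst (_ ℕ.<_) (sym z≡) (ℕ.≤-<-trans r<zk zk<)))

    -- Both k and the position before it carry 0, so no 1 fits between these two 0s.
    run-k : (q : Fin n) → z k ≡ toℕ q → onesInRun b q ≡ 0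
    run-k q zk≡q rewrite sym zk≡q = count-none (inRun? b (z k)) id go
      where
      go : ∀ x → ¬ InRun b (z k) x
      go x with position x
      ... | before _ _ z< = earlier (ℕ.<-trans z< zj<zk)
      ... | at-j _ _ z≡ = earlier (subst (ℕ._< z k) (sym z≡) zj<zk)
      ... | between _ _ _ z< _ = earlier z<
      ... | at-k _ b≡0 _ = one≢zero b≡0
      ... | after _ _ zk< = later zk<

    -- The 0 gained at j puts the new 1 at k into run q+1, in front of the old run; the 1s between j
    -- and k are delayed only up to run q.
    run-after-k : (q s : Fin n) → z k ≡ toℕ q → q ⋖ s → onesInRun b′ s ≡ suc (onesInRun b s)
    run-after-k q s zk≡q s≡ rewrite s≡ | sym zk≡q =
      count-insert (inRun? b c) (inRun? b′ c) id k
        (one≢zero bk≡0) (b′k≡1 , z′-middle j<k ℕ.≤-refl) go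
      where
      c = suc (z k)
      go : ∀ x → x ≢ k → InRun b c x ⇔ InRun b′ c x
      go x x≢k with position x
      ... | before b≡ z≡ _ = same-run b≡ z≡
      ... | at-j _ b′≡0 z≡ =
        neither (earlier (subst (ℕ._< c) (sym z≡) (ℕ.m≤n⇒m≤1+n zj<zk))) (one≢zero b′≡0)
      ... | between _ z≡ _ z< _ =
        neither (earlier (ℕ.m≤n⇒m≤1+n z<)) (earlier (subst (ℕ._< c) (sym z≡) (ℕ.s≤s z<)))
      ... | at-k x≡k _ _ = contradiction x≡k x≢k
      ... | after b≡ z≡ _ = same-run b≡ z≡

    run-beyond : (r : Fin n) → suc (z k) ℕ.< toℕ r → onesInRun b′ r ≡ onesInRun b r
    run-beyond r k<r = sym (count-cong (inRun? b c) (inRun? b′ c) id go)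
      where
      c = toℕ r
      zk<c : z k ℕ.< c
      zk<c = ℕ.<-trans (ℕ.n<1+n _) k<r
      go : ∀ x → InRun b c x ⇔ InRun b′ c x
      go x with position x
      ... | before b≡ z≡ _ = same-run b≡ z≡
      ... | at-j _ b′≡0 z≡ =
        neither (earlier (subst (ℕ._< c) (sym z≡) (ℕ.<-trans zj<zk zk<c))) (one≢zero b′≡0)
      ... | between _ z≡ _ z< _ =
        neither (earlier (ℕ.<-trans z< zk<c))
                (earlier (subst (ℕ._< c) (sym z≡) (ℕ.≤-<-trans z< zk<c)))
      ... | at-k _ b≡0 z≡ = neither (one≢zero b≡0) (earlier (subst (ℕ._< c) (sym z≡) k<r))
      ... | after b≡ z≡ _ = same-run b≡ z≡

-- Arcs at a vertex and the chords above them

not-beneath : {i s x y : Fin m} → ArcEnd s i → i < x → ¬ Beneath x y s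
not-beneath (inj₁ refl) i<x (x≤s , _) = ℕ.<⇒≱ i<x x≤s
not-beneath (inj₂ (inj₁ s⋖i)) i<x (x≤s , _) =
  ℕ.<⇒≱ (ℕ.<-trans (ℕ.≤-reflexive (sym s⋖i)) i<x) x≤s
-- Here i is the first vertex and s the arc that closes the circle, which lies beneath no chord.
not-beneath {y = y} (inj₂ (inj₂ (_ , s-last))) _ (_ , s<y) =
  ℕ.<⇒≱ (toℕ<n y) (subst (ℕ._≤ toℕ y) s-last s<y)

beneath : {j s x y : Fin m} → ArcEnd s j → x < j → j < y → Beneath x y s
beneath (inj₁ refl) x<j j<y = ℕ.<⇒≤ x<j , j<y
beneath {x = x} (inj₂ (inj₁ s⋖j)) x<j j<y =
  ℕ.s≤s⁻¹ (subst (toℕ x ℕ.<_) s⋖j x<j) , ℕ.<-trans (ℕ.≤-reflexive (sym s⋖j)) j<y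
beneath {x = x} (inj₂ (inj₂ (j≡0 , _))) x<j _ =
  contradiction (subst (toℕ x ℕ.<_) j≡0 x<j) λ ()

-- Outdegrees and partners in a plane matching

module _ (M : PlanePerfectMatching n) where
  open PlanePerfectMatching M using (partner; involutive; no-loops; plane)

  B-tail : ∀ {x y} → DirectedEdge M x y → B M x ≡ 1
  B-tail {x} {y} xy = trans
    -- Comparison with the empty predicate: the partner y is the only head of an edge directed from
    -- x.
    (count-insert {P = λ _ → ⊥} (λ _ → no id) (directedEdge? M x) id y id xy
      λ w w≢y → neither id (λ (_ , px≡w) → w≢y (trans (sym px≡w) (proj₂ xy))))
    (cong suc (count-none {P = λ _ → ⊥} (λ _ → no id) (id {A = Fin (2 * n)}) λ _ → id))

  partner-head : ∀ {x y} → partner x ≡ y → partner y ≡ x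
  partner-head {x} refl = involutive x

  B-head : ∀ {x y} → DirectedEdge M x y → B M y ≡ 0
  B-head {x} {y} (x<y , px≡y) = count-none (directedEdge? M y) id
    λ w (y<w , py≡w) → ℕ.<-asym x<y
      (subst (toℕ y ℕ.<_) (cong toℕ (trans (sym py≡w) (partner-head px≡y))) y<w)

  B-source : ∀ {x} → x < partner x → B M x ≡ 1
  B-source x<px = B-tail (x<px , refl)

  B-target : ∀ {x} → partner x < x → B M x ≡ 0
  B-target px<x = B-head (px<x , involutive _)

  -- Double counting: `partner` permutes the vertices and each edge has exactly one head, so adding
  -- the number of 0s to itself, the second copy reindexed by `partner`, gives one for each vertex.
  zeros≡n : count (λ x → B M x ℕ.≟ 0) (allFin (2 * n)) ≡ n
  zeros≡n = ℕ.*-cancelˡ-≡ _ n 2 (begin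
    2 * #zeros                                        ≡⟨ cong (#zeros +_) (ℕ.+-identityʳ _) ⟩
    #zeros + #zeros                                   ≡⟨ cong₂ _+_ #zeros≡sum #zeros≡sum ⟩
    sum isZero + sum isZero                           ≡⟨ cong (sum isZero +_) (sum-permute isZero π) ⟩
    sum isZero + sum (isZero ∘ partner)               ≡⟨ ∑-distrib-+ isZero (isZero ∘ partner) ⟨
    ∑[ x < 2 * n ] (isZero x + isZero (partner x))    ≡⟨ sum-cong-≗ one-zero-per-edge ⟩
    ∑[ x < 2 * n ] 1                                  ≡⟨ sum-ones (2 * n) ⟩
    2 * n                                             ∎)
    where
    open ≡-Reasoning
    #zeros = count (λ x → B M x ℕ.≟ 0) (allFin (2 * n))
    isZero : Fin (2 * n) → ℕ
    isZero x = indicator (B M x ℕ.≟ 0)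
    #zeros≡sum : #zeros ≡ sum isZero
    #zeros≡sum = count≡sum (λ x → B M x ℕ.≟ 0) id
    π : Permutation′ (2 * n)
    π = permutation partner partner involutive involutive
    one-zero-per-edge : ∀ x → isZero x + isZero (partner x) ≡ 1
    one-zero-per-edge x with <-cmp x (partner x)
    ... | tri< x<px _ _ rewrite B-tail (x<px , refl) | B-head (x<px , refl) = refl
    ... | tri≈ _ x≡px _ = contradiction (sym x≡px) (no-loops x)
    ... | tri> _ _ px<x rewrite B-tail (px<x , involutive x) | B-head (px<x , involutive x) = refl

  partner-inside : ∀ {a b y} → DirectedEdge M a b → a < y → y < b →
                   a < partner y × partner y < b
  partner-inside {a} {b} {y} ab a<y y<b = a<py , py<b
    where
    a<py : a < partner y
    a<py with <-cmp a (partner y)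
    ... | tri< a<py _ _ = a<py
    ... | tri≈ _ a≡py _ = contradiction
      (cong toℕ (trans (sym (partner-head (sym a≡py))) (proj₂ ab))) (ℕ.<⇒≢ y<b)
    ... | tri> _ _ py<a = contradiction (inj₂ (py<a , a<y , y<b))
      (plane _ _ _ _ ab (ℕ.<-trans py<a a<y , involutive y))
    py<b : partner y < b
    py<b with <-cmp (partner y) b
    ... | tri< py<b _ _ = py<b
    ... | tri≈ _ py≡b _ = contradiction
      (cong toℕ (trans (sym (partner-head (proj₂ ab))) (partner-head py≡b))) (ℕ.<⇒≢ a<y)
    ... | tri> _ _ b<py = contradiction (inj₁ (a<y , y<b , b<py))
      (plane _ _ _ _ ab (ℕ.<-trans y<b b<py , refl))

  partner-outside : ∀ {a b y} → DirectedEdge M a b → ¬ (a < y × y < b) →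
                    ¬ (a < partner y × partner y < b)
  partner-outside {a} {b} {y} ab y∉ (a<py , py<b) =
    y∉ (subst (λ w → a < w × w < b) (involutive y) (partner-inside ab a<py py<b))

  -- Such an edge has the arcs at j beneath it but not those at i, so no face could be incident to
  -- both i and j.
  no-separating-edge : ∀ {i j k l x y} → FourOnCommonFace M i j k l →
                       i < x → x < j → j < y → ¬ DirectedEdge M x y
  no-separating-edge (f , (s , s-i , s~f) , (t , t-j , t~f) , _) i<x x<j j<y xy =
    not-beneath s-i i<x (from (s~f _ _ xy) (to (t~f _ _ xy) (beneath t-j x<j j<y)))

  -- In the disk between the edges il and jk of a common face, the vertices on
  -- (i,j) are matched among themselves, and so are those on (k,l).
  module Flippable {i j k l : Fin (2 * n)} (i<j : i < j) (j<k : j < k) (k<l : k < l)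
                   (flippable : FlippablePair M i j k l) where
    open FlippablePair flippable

    partner-left : ∀ {y} → i < y → y < j → partner y < j
    partner-left {y} i<y y<j with <-cmp (partner y) j
    ... | tri< py<j _ _ = py<j
    ... | tri≈ _ py≡j _ = contradiction
      (cong toℕ (trans (sym (partner-head py≡j)) (proj₂ inner))) (ℕ.<⇒≢ (ℕ.<-trans y<j j<k))
    ... | tri> _ _ j<py = contradiction (ℕ.<-trans y<j j<py , refl)
      (no-separating-edge commonFace i<y y<j j<py)

    -- A partner strictly between j and k would make the edge cross jk. A partner below j would lie
    -- above i because of the edge il, and the edge would then separate i from j.
    partner-right : ∀ {y} → k < y → y < l → k < partner y
    partner-right {y} k<y y<l with <-cmp k (partner y)
    ... | tri< k<py _ _ = k<py
    ... | tri≈ _ k≡py _ = contradiction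
      (cong toℕ (trans (sym (partner-head (proj₂ inner))) (partner-head (sym k≡py))))
      (ℕ.<⇒≢ (ℕ.<-trans j<k k<y))
    ... | tri> _ _ py<k with <-cmp (partner y) j
    ...   | tri< py<j _ _ = contradiction
      (ℕ.<-trans py<j j<y , involutive y)
      (no-separating-edge commonFace (proj₁ (partner-inside outer (ℕ.<-trans i<j j<y) y<l)) py<j j<y)
      where j<y = ℕ.<-trans j<k k<y
    ...   | tri≈ _ py≡j _ = contradiction
      (cong toℕ (trans (sym (proj₂ inner)) (partner-head py≡j))) (ℕ.<⇒≢ k<y)
    ...   | tri> _ _ j<py = contradiction (j<py , py<k)
      (partner-outside inner (λ (_ , y<k) → ℕ.<-asym k<y y<k))

    before-j : ∀ y → suc (toℕ i) ℕ.< toℕ j → y ⋖ j → B M y ≡ 0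
    before-j y si<j y⋖j = B-target
      -- The partner of y lies below j, the successor of y, and differs from y; so it lies below y,
      -- which is therefore a head.
      (ℕ.≤∧≢⇒< (ℕ.s≤s⁻¹ (subst (toℕ (partner y) ℕ.<_) y⋖j (partner-left i<y y<j)))
               (no-loops y ∘ toℕ-injective))
      where
      y<j = ℕ.≤-reflexive (sym y⋖j)
      i<y = ℕ.s<s⁻¹ (subst (suc (toℕ i) ℕ.<_) y⋖j si<j)

    after-j : ∀ y → suc (toℕ j) ℕ.< toℕ k → j ⋖ y → B M y ≡ 1
    after-j y sj<k j⋖y = B-source
      (ℕ.≤∧≢⇒< (subst (ℕ._≤ toℕ (partner y)) (sym j⋖y) (proj₁ (partner-inside inner j<y y<k)))
               (≢-sym (no-loops y) ∘ toℕ-injective))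
      where
      j<y = ℕ.≤-reflexive (sym j⋖y)
      y<k = subst (ℕ._< toℕ k) (sym j⋖y) sj<k

    before-k : ∀ y → suc (toℕ j) ℕ.< toℕ k → y ⋖ k → B M y ≡ 0
    before-k y sj<k y⋖k = B-target
      (ℕ.≤∧≢⇒< (ℕ.s≤s⁻¹ (subst (toℕ (partner y) ℕ.<_) y⋖k (proj₂ (partner-inside inner j<y y<k))))
               (no-loops y ∘ toℕ-injective))
      where
      y<k = ℕ.≤-reflexive (sym y⋖k)
      j<y = ℕ.s<s⁻¹ (subst (suc (toℕ j) ℕ.<_) y⋖k sj<k)

    after-k : ∀ y → suc (toℕ k) ℕ.< toℕ l → k ⋖ y → B M y ≡ 1
    after-k y sk<l k⋖y = B-source
      (ℕ.≤∧≢⇒< (subst (ℕ._≤ toℕ (partner y)) (sym k⋖y) (partner-right k<y y<l))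
               (≢-sym (no-loops y) ∘ toℕ-injective))
      where
      k<y = ℕ.≤-reflexive (sym k⋖y)
      y<l = subst (ℕ._< toℕ l) (sym k⋖y) sk<l

    -- The indices p, q and q+1 are the numbers of 0s before j, k and k+1. They are less than n
    -- since l is a 0 at or after each of these positions.
    runIndices : suc (toℕ i) ℕ.< toℕ j → suc (toℕ j) ℕ.< toℕ k → suc (toℕ k) ℕ.< toℕ l →
                 ∃[ p ] ∃[ q ] RunIndices {n = n} (B M) j k p q
    runIndices si<j sj<k sk<l with successor k<l
    ... | x , k⋖x , x≤l = run j j≤l , run k k≤l , record
      { p<q      = subst₂ ℕ._<_ (sym (toℕ-run j j≤l)) (sym (toℕ-run k k≤l))
                     (zerosBefore-<-run (B M) (λ y → before-k y sj<k) j<k)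
      ; run-p    = B-tail inner , sym (toℕ-run j j≤l) , λ y → before-j y si<j
      ; b[j+1]≡1 = λ y → after-j y sj<k
      ; b[k-1]≡0 = λ y → before-k y sj<k
      ; b[k]≡0   = B-head inner , sym (toℕ-run k k≤l)
      ; run-[q+1] = run x x≤l , x ,
          trans (toℕ-run x x≤l)
            (trans (zerosBefore-suc (B M) k⋖x (B-head inner)) (cong suc (sym (toℕ-run k k≤l)))) ,
          k⋖x ,
          after-k x sk<l k⋖x , sym (toℕ-run x x≤l) ,
          -- The only predecessor of k+1 is k, which is a head.
          λ y y⋖x → subst (λ w → B M w ≡ 0)
            (toℕ-injective (ℕ.suc-injective (trans (sym k⋖x) y⋖x))) (B-head inner)
      }
      where
      k≤l = ℕ.<⇒≤ k<l
      j≤l = ℕ.<⇒≤ (ℕ.<-trans j<k k<l)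
      zerosBefore<n : ∀ y → y ≤ l → zerosBefore (B M) y ℕ.< n
      zerosBefore<n y y≤l =
        subst (zerosBefore (B M) y ℕ.<_) zeros≡n (zerosBefore<zeros (B M) y≤l (B-head outer))
      run : ∀ y → y ≤ l → Fin n
      run y y≤l = fromℕ< (zerosBefore<n y y≤l)
      toℕ-run : ∀ y (y≤l : y ≤ l) → toℕ (run y y≤l) ≡ zerosBefore (B M) y
      toℕ-run y y≤l = toℕ-fromℕ< (zerosBefore<n y y≤l)

-- The flip as a move of a 1, and the outdegree sequence

-- In both matchings i is a tail and l a head, though of different edges; any other vertex apart
-- from j and k has the same outgoing edges in both.
B-flip : (M M′ : PlanePerfectMatching n) {i j k l : Fin (2 * n)} →
         FlippablePair M i j k l → MatchingFlip M i j k l M′ →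
         ∀ x → x ≢ j → x ≢ k → B M′ x ≡ B M x
B-flip M M′ {i} {j} {k} {l} flippable flip x x≢j x≢k with x ≟ i | x ≟ l
... | yes refl | _ =
  trans (B-tail M′ (from (flip _ _) (inj₁ refl))) (sym (B-tail M (FlippablePair.outer flippable)))
... | no _ | yes refl =
  trans (B-head M′ (from (flip _ _) (inj₂ (inj₁ refl)))) (sym (B-head M (FlippablePair.outer flippable)))
... | no x≢i | no x≢l = count-cong (directedEdge? M′ x) (directedEdge? M x) id λ y → mk⇔
  (λ xy → [ (λ e → contradiction (,-injectiveˡ e) x≢i)
          , [ (λ e → contradiction (,-injectiveˡ e) x≢k) , proj₁ ] ] (to (flip x y) xy))
  (λ xy → from (flip x y) (inj₂ (inj₂ (xy , x≢i ∘ ,-injectiveˡ , x≢j ∘ ,-injectiveˡ))))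

proposition28 :
  (n : ℕ) (M M′ : PlanePerfectMatching n) (i j k l : Fin (2 * n)) →
  i < j → j < k → k < l →
  toℕ j > toℕ i + 2 → toℕ k > toℕ j + 2 → toℕ l > toℕ k + 2 →
  FlippablePair M i j k l →
  MatchingFlip M i j k l M′ →
  (T T′ : Triangulation n) →
  T IsTriangulationOf M → T′ IsTriangulationOf M′ →
  let a = D T
      d = D T′
  in
  -- the indices p and q exist, and for them:
  (∃[ p ] ∃[ q ] RunIndices {n = n} (B M) j k p q) ×
  ((p q : Fin n) → RunIndices (B M) j k p q →
    a q ≡ 0 ×
    (∀ r → r < p → d r ≡ a r) ×
    d p ≡ 0 ×
    (∀ s → p ⋖ s → suc (d s) ≡ a p) ×
    (∀ r s → p < r → r < q → r ⋖ s → d s ≡ a r) ×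
    (∀ s → q ⋖ s → d s ≡ a s + 1 ×
      (∀ r → s < r → d r ≡ a r)))
proposition28 n M M′ i j k l i<j j<k k<l i+2<j j+2<k k+2<l flippable flip T T′ T≡ T′≡ =
  Flippable.runIndices M i<j j<k k<l flippable (gap i+2<j) (gap j+2<k) (gap k+2<l) ,
  λ p q indices →
    let open RunIndices indices
        (bj≡1 , zj≡p , zero-before-j) = run-p
        (bk≡0 , zk≡q) = b[k]≡0
        -- In M′ the vertex j is the head of ij and k is the tail of kl.
        open MoveOne (B M) (B M′) j k j<k
               bj≡1 (B-head M′ (from (flip i j) (inj₁ refl)))
               bk≡0 (B-tail M′ (from (flip k l) (inj₂ (inj₁ refl))))
               (B-flip M M′ flippable flip) zero-before-j b[k-1]≡0
        transport : ∀ {r s} → onesInRun (B M′) s ≡ onesInRun (B M) r → D T′ s ≡ D T r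
        transport {r} {s} e = trans (T′≡ s) (trans e (sym (T≡ r)))
    in
    trans (T≡ q) (run-k q zk≡q) ,
    (λ r r<p → transport (run-before r (subst (toℕ r ℕ.<_) (sym zj≡p) r<p))) ,
    trans (T′≡ p) (run-j p zj≡p) ,
    (λ s p⋖s → trans (cong suc (T′≡ s)) (sym (trans (T≡ p) (run-after-j p s zj≡p p⋖s)))) ,
    (λ r s p<r r<q r⋖s → transport (run-between r s
      (subst (ℕ._< toℕ r) (sym zj≡p) p<r) (subst (toℕ r ℕ.<_) (sym zk≡q) r<q) r⋖s)) ,
    λ s q⋖s →
      trans (T′≡ s) (trans (run-after-k q s zk≡q q⋖s)
        (trans (ℕ.+-comm 1 _) (cong (_+ 1) (sym (T≡ s))))) ,
      λ r s<r → transport (run-beyond r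
        (subst (ℕ._< toℕ r) (trans q⋖s (cong suc (sym zk≡q))) s<r))
  where
  -- Brings a distance hypothesis into the form that supplies a neighbour strictly between the two
  -- vertices.
  gap : ∀ {x y} → x + 2 ℕ.< y → suc x ℕ.< y
  gap {x} {y} x+2<y = ℕ.<-trans (ℕ.n<1+n _) (subst (ℕ._< y) (ℕ.+-comm x 2) x+2<y)
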